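{- Let $s_n$ be the number of Fibonacci meanders with central angle $180$ degrees of length $2n$, and $S(x)=\sum_{n\geq0}s_nx^n$. With $R=(x^2+x+1)(x^2-3x+1)$, $$S(x)=\frac{x^2-x+1-\sqrt{R}}{(x-1)(x^2+x+1)(x^2-3x+1)+(x-1)(x^2-x-1)\sqrt{R}}.$$ Moreover, $S(x)=\frac{Y_1(x)}{x^2(1-x)}-1$, where $Y_1(x)=\sum_{n\ge2}\mathbf{\Delta_1}(\mathcal{A}_n)x^n$.
   Context: A Fibonacci meander with central angle $180$ degrees of length $2n$ is a word $w=w_1\cdots w_{2n}$ over $\{L,R\}$ encoding a closed smooth curve in the plane made of $2n$ semicircular arcs (arcs of angle $180^\circ$, all of the same radius): the curve starts at the origin with tangent pointing north, each arc starts at the end of the previous one with the same tangent direction, and arc $w_i$ turns counterclockwise if $w_i=L$ and clockwise if $w_i=R$. It is required that $w_1=L$, that the curve is closed (ends at the origin), and that the word has no factor $LL$ except inside the maximal initial run of $L$'s. A Dyck path with air pockets is a non-empty lattice path in the first quadrant starting at the origin, ending on the $x$-axis, with up-steps $U=(1,1)$ and down-steps $D_k=(1,-k)$, $k\ge1$, no two down-steps consecutive; $\mathcal{A}_n$ is the set of those of length (number of steps) $n$. $\mathbf{\Delta_1}(\mathcal{A}_n)$ is the total number of occurrences of the factor $UD_1$ over all paths of $\mathcal{A}_n$. -}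

module Defs where

open import Data.Nat as ℕ using (ℕ; zero; suc; _≤?_; _<ᵇ_)
open import Data.Integer as ℤ using (ℤ; +_; -[1+_])
open import Data.Bool using (Bool; true; false; if_then_else_; _∧_; not)
open import Data.List using (List; []; _∷_; length; filter; map; concatMap; upTo)
open import Data.Nat.ListAction using (sum)
open import Relation.Nullary using (Dec; yes; no; ¬_)
open import Relation.Nullary.Decidable using (⌊_⌋)

-- Generic enumeration: all words of length m over a finite alphabet
-- (given as a duplicate-free list of letters).

words : {A : Set} → List A → ℕ → List (List A)
words alph zero    = [] ∷ []
words alph (suc m) = concatMap (λ a → map (a ∷_) (words alph m)) alph

count : {A : Set} → (A → Bool) → List A → ℕ
count p xs = length (filter (λ x → Data.Bool._≟_ (p x) true) xs)
  where import Data.Bool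

data Turn : Set where
  L R : Turn

isL : Turn → Bool
isL L = true
isL R = false

-- Geometry: all arcs are semicircles of radius 1.  The tangent direction is
-- always north (true) or south (false), and each semicircle reverses it.
-- Heading north, a left (counterclockwise) semicircle moves the point by
-- (-2, 0) and a right (clockwise) one by (+2, 0); heading south it is the
-- opposite.  The y-coordinate never changes.  State = (x-coordinate, heading).

record Pos : Set where
  constructor pos
  field
    xc    : ℤ
    north : Bool

arc : Pos → Turn → Pos
arc (pos x true)  L = pos (x ℤ.- + 2) false
arc (pos x true)  R = pos (x ℤ.+ + 2) false
arc (pos x false) L = pos (x ℤ.+ + 2) true
arc (pos x false) R = pos (x ℤ.- + 2) true

trace : Pos → List Turn → Pos
trace p []       = p
trace p (t ∷ ts) = trace (arc p t) ts

-- curve ends at the origin (the y-coordinate is always 0)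
closed : List Turn → Bool
closed w = ⌊ Pos.xc (trace (pos (+ 0) true) w) ℤ.≟ + 0 ⌋

startsL : List Turn → Bool
startsL []      = false
startsL (t ∷ _) = isL t

dropInitialL : List Turn → List Turn
dropInitialL []       = []
dropInitialL (L ∷ ts) = dropInitialL ts
dropInitialL (R ∷ ts) = R ∷ ts

noLL : List Turn → Bool
noLL (L ∷ L ∷ ts) = false
noLL (t ∷ ts)     = noLL ts
noLL []           = true

isFibMeander : List Turn → Bool
isFibMeander w = startsL w ∧ closed w ∧ noLL (dropInitialL w)

s : ℕ → ℕ
s n = count isFibMeander (words (L ∷ R ∷ []) (2 ℕ.* n))

-- Dyck paths with air pockets.  D k is the step (1,-k); only k ≥ 1 is allowed.

data Step : Set where
  U : Step
  D : ℕ → Step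

isDown : Step → Bool
isDown U     = false
isDown (D _) = true

walkOK : ℕ → Bool → List Step → Bool
walkOK h prevDown []          = ⌊ h ℕ.≟ 0 ⌋
walkOK h prevDown (U ∷ ps)    = walkOK (suc h) false ps
walkOK h prevDown (D k ∷ ps)  =
  not prevDown ∧ ⌊ 1 ≤? k ⌋ ∧ ⌊ k ≤? h ⌋ ∧ walkOK (h ℕ.∸ k) true ps

isAirDyck : List Step → Bool
isAirDyck []        = false
isAirDyck (p ∷ ps)  = walkOK 0 false (p ∷ ps)

-- every path of length n uses only down-steps D k with 1 ≤ k ≤ n, so
-- A_n is enumerated over the alphabet U, D 1, ..., D n
stepsUpTo : ℕ → List Step
stepsUpTo n = U ∷ map (λ i → D (suc i)) (upTo n)

A : ℕ → List (List Step)
A n = filter (λ p → Data.Bool._≟_ (isAirDyck p) true) (words (stepsUpTo n) n)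
  where import Data.Bool

occUD1 : List Step → ℕ
occUD1 (U ∷ ps) = startsD1 ps ℕ.+ occUD1 ps
  where
  startsD1 : List Step → ℕ
  startsD1 (D 1 ∷ _) = 1
  startsD1 _         = 0
occUD1 (D _ ∷ ps) = occUD1 ps
occUD1 []         = 0

Δ₁ : ℕ → ℕ
Δ₁ n = sum (map occUD1 (A n))

FPS : Set
FPS = ℕ → ℤ

_⊕_ : FPS → FPS → FPS
(f ⊕ g) n = f n ℤ.+ g n

⊝_ : FPS → FPS
(⊝ f) n = ℤ.- f n

infixl 6 _⊕_
infixl 7 _⊛_

_⊛_ : FPS → FPS → FPS
(f ⊛ g) n = go n
  where
  go : ℕ → ℤ
  go zero    = f 0 ℤ.* g n
  go (suc i) = go i ℤ.+ f (suc i) ℤ.* g (n ℕ.∸ suc i)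

poly : List ℤ → FPS
poly []       n       = + 0
poly (c ∷ cs) zero    = c
poly (c ∷ cs) (suc n) = poly cs n

ogf : (ℕ → ℕ) → FPS
ogf a n = + a n

S : FPS
S = ogf s

Y₁ : FPS
Y₁ n = if n <ᵇ 2 then + 0 else + Δ₁ n

x²+x+1 x²-3x+1 x-1 x²-x-1 x²-x+1 x²[1-x] one : FPS
x²+x+1  = poly (+ 1 ∷ + 1 ∷ + 1 ∷ [])
x²-3x+1 = poly (+ 1 ∷ ℤ.- + 3 ∷ + 1 ∷ [])
x-1     = poly (ℤ.- + 1 ∷ + 1 ∷ [])
x²-x-1  = poly (ℤ.- + 1 ∷ ℤ.- + 1 ∷ + 1 ∷ [])
x²-x+1  = poly (+ 1 ∷ ℤ.- + 1 ∷ + 1 ∷ [])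
x²[1-x] = poly (+ 0 ∷ + 0 ∷ + 1 ∷ ℤ.- + 1 ∷ [])
one     = poly (+ 1 ∷ [])

Rpoly : FPS
Rpoly = x²+x+1 ⊛ x²-3x+1

IsSqrtR : FPS → Set
IsSqrtR T = (T 0 Relation.Binary.PropositionalEquality.≡ + 1)
  Data.Product.× (∀ n → (T ⊛ T) n Relation.Binary.PropositionalEquality.≡ Rpoly n)
  where import Relation.Binary.PropositionalEquality
        import Data.Product

numer denom : FPS → FPS
numer T = x²-x+1 ⊕ (⊝ T)
denom T = (x-1 ⊛ x²+x+1 ⊛ x²-3x+1) ⊕ (x-1 ⊛ x²-x-1 ⊛ T)

{-# OPTIONS --safe #-}
module Submission where

-- Both counting problems reduce to linear systems over ℤ[[x]] whose solution is unique because
-- every unknown on the right-hand side carries a factor x; closed forms are then checked by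
-- substitution.  All of them are polynomials in x and the series z = x(1+z)(1+xz), and
-- √R = 1 - x - x² - 2x²z.
--
-- Meanders: after the initial run of L's, read the word in pairs LR, RL, RR (displacements -4, +4, 0
-- for semicircles of radius 1), with RL·LR forbidden.  The closing words starting from 4j have
-- generating function q^|j|/√R with q = x(1+z).
--
-- Air pockets: in a valid path every D₁ is preceded by U, so Δ₁ counts the steps D₁.  The suffixes
-- starting at height h have generating functions that are geometric in h with ratio ρ = 1 + xz, and
-- their total numbers of D₁ are, up to the factor 1/√R, of the form (a + b h) ρ^h.

open import Defs
open import Algebra.Bundles using (CommutativeRing)
import Algebra.Solver.Ring as RingSolver
open import Algebra.Solver.Ring.AlmostCommutativeRing using (fromCommutativeRing; _-Raw-AlmostCommutative⟶_)
open import Data.Bool using (Bool; true; false; _∧_; if_then_else_; _≟_)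
open import Data.Bool.Properties using (∧-zeroʳ)
open import Data.Integer as ℤ using (ℤ; +_; -[1+_]; 0ℤ; 1ℤ; -1ℤ)
import Data.Integer.Properties as ℤₚ
open import Data.Integer.Tactic.RingSolver using (solve-∀)
open import Data.List using (List; []; _∷_; map; filter; concatMap; _++_; applyUpTo; upTo)
open import Data.List.Properties using (map-++; map-∘; map-cong; map-applyUpTo)
open import Data.Maybe using (Maybe; just; nothing)
open import Data.Nat as ℕ using (ℕ; zero; suc; _∸_; _<ᵇ_)
open import Data.Nat.ListAction using (sum)
open import Data.Nat.ListAction.Properties using (sum-++)
import Data.Nat.Properties as ℕₚ
open import Algebra.Properties.CommutativeSemigroup ℕₚ.+-commutativeSemigroup using (interchange)
open import Data.Product using (_×_; _,_; proj₂)
open import Function using (_∘_; id)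
open import Level using (0ℓ)
open import Relation.Binary.PropositionalEquality using (_≡_; refl; sym; trans; cong; cong₂; module ≡-Reasoning)
open import Relation.Nullary using (yes; no)
open import Relation.Nullary.Decidable using (⌊_⌋; isYes≗does)

-- The ring of formal power series

infix 4 _≈_

record _≈_ (f g : FPS) : Set where
  constructor coeffwise
  field
    coeff : ∀ n → f n ≡ g n

open _≈_

Σ≤ : ℕ → (ℕ → ℤ) → ℤ
Σ≤ zero    a = a 0
Σ≤ (suc k) a = Σ≤ k a ℤ.+ a (suc k)

-- The loop inside _⊛_ is a local function with no accessible name.  Abstracting suc n and _+_ turns
-- it into a pattern that unification can use to fill in the left-hand side of partial-Σ≤.
mutual
  ⊛-Σ≤ : ∀ f g n → (f ⊛ g) n ≡ Σ≤ n (λ i → f i ℤ.* g (n ∸ i))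
  ⊛-Σ≤ f g zero = refl
  ⊛-Σ≤ f g (suc n) with suc n | ℤ._+_
  ... | w | _✢_ = cong (_✢ (f w ℤ.* g (n ∸ n))) (partial-Σ≤ f g w n)

  partial-Σ≤ : ∀ (f g : FPS) n k → _ ≡ Σ≤ k (λ i → f i ℤ.* g (n ∸ i))
  partial-Σ≤ f g n zero    = refl
  partial-Σ≤ f g n (suc k) = cong (ℤ._+ f (suc k) ℤ.* g (n ∸ suc k)) (partial-Σ≤ f g n k)

tail : FPS → FPS
tail f n = f (suc n)

Σ≤-head : ∀ k a → Σ≤ (suc k) a ≡ a 0 ℤ.+ Σ≤ k (tail a)
Σ≤-head zero    a = refl
Σ≤-head (suc k) a = trans (cong (ℤ._+ a (suc (suc k))) (Σ≤-head k a)) (ℤₚ.+-assoc (a 0) _ _)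

-- Splitting off the head of the left factor gives a recursion in which `f` becomes `tail f` and `g`
-- stays fixed. The ring laws below follow from it by induction on the index, with the series
-- generalised.
⊛-suc : ∀ f g n → (f ⊛ g) (suc n) ≡ f 0 ℤ.* g (suc n) ℤ.+ (tail f ⊛ g) n
⊛-suc f g n = begin
  (f ⊛ g) (suc n)                                              ≡⟨ ⊛-Σ≤ f g (suc n) ⟩
  Σ≤ (suc n) (λ i → f i ℤ.* g (suc n ∸ i))                     ≡⟨ Σ≤-head n _ ⟩
  f 0 ℤ.* g (suc n) ℤ.+ Σ≤ n (λ i → tail f i ℤ.* g (n ∸ i))    ≡⟨ cong (ℤ._+_ (f 0 ℤ.* g (suc n))) (⊛-Σ≤ (tail f) g n) ⟨
  f 0 ℤ.* g (suc n) ℤ.+ (tail f ⊛ g) n                         ∎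
  where open ≡-Reasoning

infixr 7 _·_

_·_ : ℤ → FPS → FPS
(c · f) n = c ℤ.* f n

0# : FPS
0# _ = 0ℤ

const : ℤ → FPS
const c = poly (c ∷ [])

X : FPS
X = poly (0ℤ ∷ 1ℤ ∷ [])

≈-refl : ∀ {f} → f ≈ f
≈-refl = coeffwise λ _ → refl

≈-sym : ∀ {f g} → f ≈ g → g ≈ f
≈-sym p = coeffwise λ n → sym (coeff p n)

≈-trans : ∀ {f g h} → f ≈ g → g ≈ h → f ≈ h
≈-trans p q = coeffwise λ n → trans (coeff p n) (coeff q n)

⊕-cong : ∀ {f f′ g g′} → f ≈ f′ → g ≈ g′ → f ⊕ g ≈ f′ ⊕ g′
⊕-cong p q = coeffwise λ n → cong₂ ℤ._+_ (coeff p n) (coeff q n)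

⊝-cong : ∀ {f g} → f ≈ g → ⊝ f ≈ ⊝ g
⊝-cong p = coeffwise λ n → cong ℤ.-_ (coeff p n)

-- A product coefficient depends only on coefficients of no larger index. This finite form, stronger
-- than congruence, is what makes the approximations of `z` stabilise.
⊛-cong-≤ : ∀ n {f f′ g g′} → (∀ i → i ℕ.≤ n → f i ≡ f′ i) → (∀ i → i ℕ.≤ n → g i ≡ g′ i) →
           (f ⊛ g) n ≡ (f′ ⊛ g′) n
⊛-cong-≤ zero p q = cong₂ ℤ._*_ (p 0 ℕ.z≤n) (q 0 ℕ.z≤n)
⊛-cong-≤ (suc n) {f} {f′} {g} {g′} p q = begin
  (f ⊛ g) (suc n)
    ≡⟨ ⊛-suc f g n ⟩
  f 0 ℤ.* g (suc n) ℤ.+ (tail f ⊛ g) n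
    ≡⟨ cong₂ ℤ._+_ (cong₂ ℤ._*_ (p 0 ℕ.z≤n) (q (suc n) ℕₚ.≤-refl))
                   (⊛-cong-≤ n (λ i i≤n → p (suc i) (ℕ.s≤s i≤n)) (λ i i≤n → q i (ℕₚ.m≤n⇒m≤1+n i≤n))) ⟩
  f′ 0 ℤ.* g′ (suc n) ℤ.+ (tail f′ ⊛ g′) n
    ≡⟨ ⊛-suc f′ g′ n ⟨
  (f′ ⊛ g′) (suc n) ∎
  where open ≡-Reasoning

⊛-cong : ∀ {f f′ g g′} → f ≈ f′ → g ≈ g′ → f ⊛ g ≈ f′ ⊛ g′
⊛-cong p q = coeffwise λ n → ⊛-cong-≤ n (λ i _ → coeff p i) (λ i _ → coeff q i)

private
  distribʳₙ : ∀ h f g n → ((f ⊕ g) ⊛ h) n ≡ (f ⊛ h ⊕ g ⊛ h) n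
  distribʳₙ h f g zero = ℤₚ.*-distribʳ-+ (h 0) (f 0) (g 0)
  distribʳₙ h f g (suc n)
    rewrite ⊛-suc (f ⊕ g) h n | ⊛-suc f h n | ⊛-suc g h n | distribʳₙ h (tail f) (tail g) n
    = lemma (f 0) (g 0) (h (suc n)) _ _
    where
    lemma : ∀ a b c p q → (a ℤ.+ b) ℤ.* c ℤ.+ (p ℤ.+ q) ≡ (a ℤ.* c ℤ.+ p) ℤ.+ (b ℤ.* c ℤ.+ q)
    lemma = solve-∀

  ·-⊛ₙ : ∀ c f g n → ((c · f) ⊛ g) n ≡ (c · (f ⊛ g)) n
  ·-⊛ₙ c f g zero = ℤₚ.*-assoc c (f 0) (g 0)
  ·-⊛ₙ c f g (suc n)
    rewrite ⊛-suc (c · f) g n | ⊛-suc f g n | ·-⊛ₙ c (tail f) g n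
    = lemma c (f 0) (g (suc n)) _
    where
    lemma : ∀ c a b p → (c ℤ.* a) ℤ.* b ℤ.+ c ℤ.* p ≡ c ℤ.* (a ℤ.* b ℤ.+ p)
    lemma = solve-∀

  assocₙ : ∀ f g h n → ((f ⊛ g) ⊛ h) n ≡ (f ⊛ (g ⊛ h)) n
  assocₙ f g h zero = ℤₚ.*-assoc (f 0) (g 0) (h 0)
  assocₙ f g h (suc n) = begin
    ((f ⊛ g) ⊛ h) (suc n)
      ≡⟨ ⊛-suc (f ⊛ g) h n ⟩
    a ℤ.* b ℤ.* c ℤ.+ (tail (f ⊛ g) ⊛ h) n
      ≡⟨ cong (ℤ._+_ (a ℤ.* b ℤ.* c)) (coeff (⊛-cong (coeffwise (⊛-suc f g)) (≈-refl {h})) n) ⟩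
    a ℤ.* b ℤ.* c ℤ.+ ((f 0 · tail g ⊕ tail f ⊛ g) ⊛ h) n
      ≡⟨ cong (ℤ._+_ (a ℤ.* b ℤ.* c)) (distribʳₙ h (f 0 · tail g) (tail f ⊛ g) n) ⟩
    a ℤ.* b ℤ.* c ℤ.+ (((f 0 · tail g) ⊛ h) n ℤ.+ ((tail f ⊛ g) ⊛ h) n)
      ≡⟨ cong (ℤ._+_ (a ℤ.* b ℤ.* c)) (cong₂ ℤ._+_ (·-⊛ₙ (f 0) (tail g) h n) (assocₙ (tail f) g h n)) ⟩
    a ℤ.* b ℤ.* c ℤ.+ (a ℤ.* (tail g ⊛ h) n ℤ.+ (tail f ⊛ (g ⊛ h)) n)
      ≡⟨ lemma a b c _ _ ⟩
    a ℤ.* (b ℤ.* c ℤ.+ (tail g ⊛ h) n) ℤ.+ (tail f ⊛ (g ⊛ h)) n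
      ≡⟨ cong (λ t → a ℤ.* t ℤ.+ (tail f ⊛ (g ⊛ h)) n) (⊛-suc g h n) ⟨
    a ℤ.* (g ⊛ h) (suc n) ℤ.+ (tail f ⊛ (g ⊛ h)) n
      ≡⟨ ⊛-suc f (g ⊛ h) n ⟨
    (f ⊛ (g ⊛ h)) (suc n) ∎
    where
    open ≡-Reasoning
    a = f 0
    b = g 0
    c = h (suc n)
    lemma : ∀ a b c p q → a ℤ.* b ℤ.* c ℤ.+ (a ℤ.* p ℤ.+ q) ≡ a ℤ.* (b ℤ.* c ℤ.+ p) ℤ.+ q
    lemma = solve-∀

  ⊛-sucʳ : ∀ f g n → (f ⊛ g) (suc n) ≡ (f ⊛ tail g) n ℤ.+ f (suc n) ℤ.* g 0
  ⊛-sucʳ f g zero = ⊛-suc f g 0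
  ⊛-sucʳ f g (suc n)
    rewrite ⊛-suc f g (suc n) | ⊛-sucʳ (tail f) g n | ⊛-suc f (tail g) n
    = sym (ℤₚ.+-assoc (f 0 ℤ.* g (suc (suc n))) _ _)

  commₙ : ∀ f g n → (f ⊛ g) n ≡ (g ⊛ f) n
  commₙ f g zero = ℤₚ.*-comm (f 0) (g 0)
  commₙ f g (suc n)
    rewrite ⊛-suc f g n | ⊛-sucʳ g f n | commₙ (tail f) g n | ℤₚ.*-comm (f 0) (g (suc n))
    = ℤₚ.+-comm (g (suc n) ℤ.* f 0) _

  zeroˡₙ : ∀ f n → (0# ⊛ f) n ≡ 0ℤ
  zeroˡₙ f zero = refl
  zeroˡₙ f (suc n) rewrite ⊛-suc 0# f n | zeroˡₙ f n = refl

const-⊛ : ∀ c f → const c ⊛ f ≈ c · f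
const-⊛ c f = coeffwise go
  where
  go : ∀ n → (const c ⊛ f) n ≡ c ℤ.* f n
  go zero = refl
  go (suc n) rewrite ⊛-suc (const c) f n | zeroˡₙ f n = ℤₚ.+-identityʳ _

X-⊛-suc : ∀ f n → (X ⊛ f) (suc n) ≡ f n
X-⊛-suc f n = trans (⊛-suc X f n) (trans (ℤₚ.+-identityˡ _)
  (trans (coeff (const-⊛ 1ℤ f) n) (ℤₚ.*-identityˡ (f n))))

⊛-comm : ∀ f g → f ⊛ g ≈ g ⊛ f
⊛-comm f g = coeffwise (commₙ f g)

⊛-identityˡ : ∀ f → const 1ℤ ⊛ f ≈ f
⊛-identityˡ f = coeffwise λ n → trans (coeff (const-⊛ 1ℤ f) n) (ℤₚ.*-identityˡ (f n))

⊛-distribʳ : ∀ h f g → (f ⊕ g) ⊛ h ≈ f ⊛ h ⊕ g ⊛ h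
⊛-distribʳ h f g = coeffwise (distribʳₙ h f g)

FPS-commutativeRing : CommutativeRing 0ℓ 0ℓ
FPS-commutativeRing = record
  { Carrier = FPS ; _≈_ = _≈_ ; _+_ = _⊕_ ; _*_ = _⊛_ ; -_ = ⊝_ ; 0# = 0# ; 1# = const 1ℤ
  ; isCommutativeRing = record
    { isRing = record
      { +-isAbelianGroup = record
        { isGroup = record
          { isMonoid = record
            { isSemigroup = record
              { isMagma = record
                { isEquivalence = record { refl = ≈-refl ; sym = ≈-sym ; trans = ≈-trans }
                ; ∙-cong = ⊕-cong }
              ; assoc = λ f g h → coeffwise λ n → ℤₚ.+-assoc (f n) (g n) (h n) }
            ; identity = (λ f → coeffwise λ n → ℤₚ.+-identityˡ (f n))
                       , (λ f → coeffwise λ n → ℤₚ.+-identityʳ (f n)) }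
          ; inverse = (λ f → coeffwise λ n → ℤₚ.+-inverseˡ (f n))
                    , (λ f → coeffwise λ n → ℤₚ.+-inverseʳ (f n))
          ; ⁻¹-cong = ⊝-cong }
        ; comm = λ f g → coeffwise λ n → ℤₚ.+-comm (f n) (g n) }
      ; *-cong = ⊛-cong
      ; *-assoc = λ f g h → coeffwise (assocₙ f g h)
      ; *-identity = ⊛-identityˡ , (λ f → ≈-trans (⊛-comm f (const 1ℤ)) (⊛-identityˡ f))
      ; distrib = (λ h f g → ≈-trans (⊛-comm h (f ⊕ g)) (≈-trans (⊛-distribʳ h f g)
                               (⊕-cong (⊛-comm f h) (⊛-comm g h))))
                , ⊛-distribʳ
      }
    ; *-comm = ⊛-comm
    }
  }

-- Embedding ℤ as constant series lets the ring solver normalise with integer coefficients, whose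
-- equality is decidable.
const-morphism : CommutativeRing.rawRing ℤₚ.+-*-commutativeRing -Raw-AlmostCommutative⟶ fromCommutativeRing FPS-commutativeRing
const-morphism = record
  { ⟦_⟧    = const
  ; +-homo = λ a b → coeffwise λ { zero → refl ; (suc n) → refl }
  ; *-homo = λ a b → ≈-trans (coeffwise λ { zero → refl ; (suc n) → sym (ℤₚ.*-zeroʳ a) })
                             (≈-sym (const-⊛ a (const b)))
  ; -‿homo = λ a → coeffwise λ { zero → refl ; (suc n) → refl }
  ; 0-homo = coeffwise λ { zero → refl ; (suc n) → refl }
  ; 1-homo = ≈-refl
  }

const-≟ : ∀ a b → Maybe (const a ≈ const b)
const-≟ a b with a ℤ.≟ b
... | yes refl = just ≈-refl
... | no _     = nothing

open RingSolver (CommutativeRing.rawRing ℤₚ.+-*-commutativeRing) (fromCommutativeRing FPS-commutativeRing) const-morphism const-≟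
  using (Polynomial; solve; _:=_; _:+_; _:*_; :-_; con)

-- The series z and the square root of R

cons-≈ : ∀ {f g c} → f 0 ≡ c → (∀ n → f (suc n) ≡ g n) → f ≈ const c ⊕ X ⊛ g
cons-≈ {f} {g} {c} f₀ fₛ = coeffwise λ
  { zero    → trans f₀ (sym (ℤₚ.+-identityʳ c))
  ; (suc n) → trans (fₛ n) (trans (sym (X-⊛-suc g n)) (sym (ℤₚ.+-identityˡ _))) }

-- The lowest coefficient of the product forces `f 0` to vanish; then `tail f ⊛ g` vanishes as well,
-- and the argument repeats.
⊛-zero-cancel : ∀ g .{{_ : ℤ.NonZero (g 0)}} f → f ⊛ g ≈ 0# → f ≈ 0#
⊛-zero-cancel g f fg≈0 = coeffwise (go f (coeff fg≈0))
  where
  open ≡-Reasoning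
  head≡0 : ∀ f → (∀ n → (f ⊛ g) n ≡ 0ℤ) → f 0 ≡ 0ℤ
  head≡0 f fg = ℤₚ.*-cancelʳ-≡ (f 0) 0ℤ (g 0) (fg 0)
  go : ∀ f → (∀ n → (f ⊛ g) n ≡ 0ℤ) → ∀ n → f n ≡ 0ℤ
  go f fg zero    = head≡0 f fg
  go f fg (suc n) = go (tail f) tail-fg n
    where
    tail-fg : ∀ n → (tail f ⊛ g) n ≡ 0ℤ
    tail-fg n = begin
      (tail f ⊛ g) n                          ≡⟨ ℤₚ.+-identityˡ _ ⟨
      0ℤ ℤ.* g (suc n) ℤ.+ (tail f ⊛ g) n     ≡⟨ cong (λ a → a ℤ.* g (suc n) ℤ.+ (tail f ⊛ g) n) (head≡0 f fg) ⟨
      f 0 ℤ.* g (suc n) ℤ.+ (tail f ⊛ g) n    ≡⟨ ⊛-suc f g n ⟨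
      (f ⊛ g) (suc n)                         ≡⟨ fg (suc n) ⟩
      0ℤ                                      ∎

⊖-zero : ∀ {f g} → f ≈ g → f ⊕ ⊝ g ≈ 0#
⊖-zero {f} {g} f≈g = coeffwise λ n → ℤₚ.i≡j⇒i-j≡0 (coeff f≈g n)

zero-⊖ : ∀ {f g} → f ⊕ ⊝ g ≈ 0# → f ≈ g
zero-⊖ {f} {g} p = coeffwise λ n → ℤₚ.i-j≡0⇒i≡j (f n) (g n) (coeff p n)

⊛-cancelʳ : ∀ g .{{_ : ℤ.NonZero (g 0)}} {f f′} → f ⊛ g ≈ f′ ⊛ g → f ≈ f′
⊛-cancelʳ g {f} {f′} p = zero-⊖ (⊛-zero-cancel g (f ⊕ ⊝ f′) (≈-trans
  (solve 3 (λ f f′ g → (f :+ :- f′) :* g := f :* g :+ :- (f′ :* g)) ≈-refl f f′ g) (⊖-zero p)))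

-- To prove l ≈ r from a ≈ b it suffices to exhibit the cofactor k of the relation.
modulo : ∀ k {a b l r} → a ≈ b → l ≈ r ⊕ k ⊛ (a ⊕ ⊝ b) → l ≈ r
modulo k {a} {b} {l} {r} a≈b p = ≈-trans p (≈-trans
  (⊕-cong (≈-refl {r}) (⊛-cong (≈-refl {k}) (⊕-cong a≈b (≈-refl {⊝ b}))))
  (solve 3 (λ r k b → r :+ k :* (b :+ :- b) := r) ≈-refl r k b))

-- The factor `X` makes coefficient n + 1 of every unknown depend on `Φ` at index n, and `Φ` acts
-- coefficientwise. Induction on n, for all indices `i` at once, therefore handles infinite systems.
guarded-unique : {I : Set} (c : I → FPS) (Φ : (I → FPS) → I → FPS) →
  (∀ f g n → (∀ i → f i n ≡ g i n) → ∀ i → Φ f i n ≡ Φ g i n) →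
  ∀ {f g} → (∀ i → f i ≈ c i ⊕ X ⊛ Φ f i) → (∀ i → g i ≈ c i ⊕ X ⊛ Φ g i) → ∀ i → f i ≈ g i
guarded-unique c Φ Φ-local {f} {g} fix-f fix-g i = coeffwise λ n → go n i
  where
  go : ∀ n i → f i n ≡ g i n
  go zero    i = trans (coeff (fix-f i) 0) (sym (coeff (fix-g i) 0))
  go (suc n) i = begin
    f i (suc n)                           ≡⟨ coeff (fix-f i) (suc n) ⟩
    c i (suc n) ℤ.+ (X ⊛ Φ f i) (suc n)   ≡⟨ cong (ℤ._+_ (c i (suc n))) (X-⊛-suc (Φ f i) n) ⟩
    c i (suc n) ℤ.+ Φ f i n               ≡⟨ cong (ℤ._+_ (c i (suc n))) (Φ-local f g n (go n) i) ⟩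
    c i (suc n) ℤ.+ Φ g i n               ≡⟨ cong (ℤ._+_ (c i (suc n))) (X-⊛-suc (Φ g i) n) ⟨
    c i (suc n) ℤ.+ (X ⊛ Φ g i) (suc n)   ≡⟨ coeff (fix-g i) (suc n) ⟨
    g i (suc n)                           ∎
    where open ≡-Reasoning

z-step : FPS → FPS
z-step f = (const 1ℤ ⊕ f) ⊛ (const 1ℤ ⊕ X ⊛ f)

z-approx : ℕ → FPS
z-approx zero    = 0#
z-approx (suc k) = X ⊛ z-step (z-approx k)

-- Diagonal of the fixed-point iteration: coefficient n no longer changes after n + 1 rounds.
z : FPS
z n = z-approx (suc n) n

z-step-local : ∀ n {f g} → (∀ i → i ℕ.≤ n → f i ≡ g i) → z-step f n ≡ z-step g n
z-step-local n f≡g = ⊛-cong-≤ n (λ i i≤n → cong (ℤ._+_ (const 1ℤ i)) (f≡g i i≤n))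
  (λ i i≤n → cong (ℤ._+_ (const 1ℤ i)) (⊛-cong-≤ i (λ _ _ → refl) (λ j j≤i → f≡g j (ℕₚ.≤-trans j≤i i≤n))))

z-approx-agree : ∀ k l n → n ℕ.< k → n ℕ.< l → z-approx k n ≡ z-approx l n
z-approx-agree (suc k) (suc l) zero    _ _ = refl
z-approx-agree (suc k) (suc l) (suc n) (ℕ.s≤s n<k) (ℕ.s≤s n<l) = begin
  (X ⊛ z-step (z-approx k)) (suc n)   ≡⟨ X-⊛-suc (z-step (z-approx k)) n ⟩
  z-step (z-approx k) n               ≡⟨ z-step-local n (λ i i≤n →
      z-approx-agree k l i (ℕₚ.≤-<-trans i≤n n<k) (ℕₚ.≤-<-trans i≤n n<l)) ⟩
  z-step (z-approx l) n               ≡⟨ X-⊛-suc (z-step (z-approx l)) n ⟨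
  (X ⊛ z-step (z-approx l)) (suc n)   ∎
  where open ≡-Reasoning

z-equation : z ≈ X ⊛ z-step z
z-equation = coeffwise λ
  { zero    → refl
  ; (suc n) → trans (X-⊛-suc (z-step (z-approx (suc n))) n)
      (trans (z-step-local n (λ i i≤n → z-approx-agree (suc n) (suc i) i (ℕ.s≤s i≤n) ℕₚ.≤-refl)) (sym (X-⊛-suc (z-step z) n))) }

-- The equation of `z` reads x²z² - (1 - x - x²)z + x = 0. Its discriminant (1 - x - x²)² - 4x³
-- equals R, and solving for the root gives this expression.
T₀ : FPS
T₀ = const 1ℤ ⊕ ⊝ X ⊕ ⊝ (X ⊛ X) ⊕ ⊝ (const (+ 2) ⊛ X ⊛ X ⊛ z)

q : FPS
q = X ⊛ (const 1ℤ ⊕ z)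

-- Horner form rewrites a coefficient list as a ring expression in `X`, which the solver can process
-- through its mirror image `:horner`.
horner : List ℤ → FPS
horner []       = const 0ℤ
horner (c ∷ cs) = const c ⊕ X ⊛ horner cs

poly≈horner : ∀ cs → poly cs ≈ horner cs
poly≈horner []       = coeffwise λ { zero → refl ; (suc n) → refl }
poly≈horner (c ∷ cs) = ≈-trans (cons-≈ refl (λ _ → refl))
  (⊕-cong (≈-refl {const c}) (⊛-cong (≈-refl {X}) (poly≈horner cs)))

:horner : ∀ {n} → List ℤ → Polynomial n → Polynomial n
:horner []       x = con 0ℤ
:horner (c ∷ cs) x = con c :+ x :* :horner cs x

:T₀ :q :z-relation : ∀ {n} → Polynomial n → Polynomial n → Polynomial n
:T₀ x z = con 1ℤ :+ :- x :+ :- (x :* x) :+ :- (con (+ 2) :* x :* x :* z)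
:q x z = x :* (con 1ℤ :+ z)
:z-relation x z = z :+ :- (x :* ((con 1ℤ :+ z) :* (con 1ℤ :+ x :* z)))

T₀²≈R : T₀ ⊛ T₀ ≈ Rpoly
T₀²≈R = ≈-trans (modulo (const (ℤ.- + 4) ⊛ X ⊛ X) z-equation
    (solve 2 (λ x z → :T₀ x z :* :T₀ x z
        := :horner p₁ x :* :horner p₂ x :+ con (ℤ.- + 4) :* x :* x :* :z-relation x z)
      ≈-refl X z))
  (≈-sym (⊛-cong (poly≈horner p₁) (poly≈horner p₂)))
  where
  p₁ p₂ : List ℤ
  p₁ = + 1 ∷ + 1 ∷ + 1 ∷ []
  p₂ = + 1 ∷ ℤ.- + 3 ∷ + 1 ∷ []

-- Difference of squares: (T - T₀)(T + T₀) = 0, and the second factor has constant term 2, so it can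
-- be cancelled.
sqrt-unique : ∀ T → IsSqrtR T → T ≈ T₀
sqrt-unique T (T0≡1 , T²≈R) = zero-⊖ (⊛-zero-cancel (T ⊕ T₀) {{nonZero}} (T ⊕ ⊝ T₀) (≈-trans
  (solve 2 (λ s t → (s :+ :- t) :* (s :+ t) := s :* s :+ :- (t :* t)) ≈-refl T T₀)
  (⊖-zero (≈-trans (coeffwise T²≈R) (≈-sym T₀²≈R)))))
  where
  nonZero : ℤ.NonZero (T 0 ℤ.+ 1ℤ)
  nonZero rewrite T0≡1 = _

-- Fibonacci meanders

total : {A : Set} → List A → (List A → ℕ) → ℕ → ℕ
total alph w m = sum (map w (words alph m))

total-suc : ∀ {A : Set} (alph : List A) w m →
  total alph w (suc m) ≡ sum (map (λ a → total alph (w ∘ (a ∷_)) m) alph)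
total-suc {A} alph w m = go alph
  where
  open ≡-Reasoning
  go : ∀ as → sum (map w (concatMap (λ a → map (a ∷_) (words alph m)) as))
            ≡ sum (map (λ a → total alph (w ∘ (a ∷_)) m) as)
  go []       = refl
  go (a ∷ as) = begin
    sum (map w (map (a ∷_) (words alph m) ++ rest))           ≡⟨ cong sum (map-++ w (map (a ∷_) (words alph m)) rest) ⟩
    sum (map w (map (a ∷_) (words alph m)) ++ map w rest)     ≡⟨ sum-++ (map w (map (a ∷_) (words alph m))) (map w rest) ⟩
    sum (map w (map (a ∷_) (words alph m))) ℕ.+ sum (map w rest)
      ≡⟨ cong₂ ℕ._+_ (cong sum (sym (map-∘ (words alph m)))) (go as) ⟩
    total alph (w ∘ (a ∷_)) m ℕ.+ sum (map (λ a → total alph (w ∘ (a ∷_)) m) as) ∎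
    where rest = concatMap (λ a → map (a ∷_) (words alph m)) as

total-cong : ∀ {A : Set} (alph : List A) {v w} → (∀ u → v u ≡ w u) → ∀ m → total alph v m ≡ total alph w m
total-cong alph v≡w m = cong sum (map-cong v≡w (words alph m))

sum-filter : ∀ {A : Set} (p : A → Bool) (w : A → ℕ) xs →
  sum (map w (filter (λ x → p x ≟ true) xs)) ≡ sum (map (λ x → if p x then w x else 0) xs)
sum-filter p w [] = refl
sum-filter p w (x ∷ xs) with p x
... | true  = cong (w x ℕ.+_) (sum-filter p w xs)
... | false = sum-filter p w xs

count-sum : ∀ {A : Set} (p : A → Bool) xs → count p xs ≡ sum (map (λ x → if p x then 1 else 0) xs)
count-sum p [] = refl
count-sum p (x ∷ xs) with p x
... | true  = cong suc (count-sum p xs)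
... | false = count-sum p xs

LR : List Turn
LR = L ∷ R ∷ []

-- Two arcs restore the northward heading, so reading letters in pairs leaves only the x-coordinate
-- to track; x marks one pair.
pairs : (List Turn → ℕ) → FPS
pairs w n = + total LR w (2 ℕ.* n)

pairs-cong : ∀ {v w} → (∀ u → v u ≡ w u) → pairs v ≈ pairs w
pairs-cong v≡w = coeffwise λ n → cong +_ (total-cong LR v≡w (2 ℕ.* n))

pairs-unfold : ∀ w → pairs w ≈ const (+ w []) ⊕ X ⊛
  (pairs (w ∘ (L ∷_) ∘ (L ∷_)) ⊕ pairs (w ∘ (L ∷_) ∘ (R ∷_)) ⊕ pairs (w ∘ (R ∷_) ∘ (L ∷_)) ⊕ pairs (w ∘ (R ∷_) ∘ (R ∷_)))
pairs-unfold w = cons-≈ (cong +_ (ℕₚ.+-identityʳ (w []))) λ n → cong +_ (begin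
  total LR w (2 ℕ.* suc n)
    ≡⟨ cong (total LR w) (ℕₚ.*-suc 2 n) ⟩
  total LR w (suc (suc (2 ℕ.* n)))
    ≡⟨ two w (suc (2 ℕ.* n)) ⟩
  total LR (w ∘ (L ∷_)) (suc (2 ℕ.* n)) ℕ.+ total LR (w ∘ (R ∷_)) (suc (2 ℕ.* n))
    ≡⟨ cong₂ ℕ._+_ (two (w ∘ (L ∷_)) (2 ℕ.* n)) (two (w ∘ (R ∷_)) (2 ℕ.* n)) ⟩
  _ ≡⟨ ℕₚ.+-assoc (total LR (w ∘ (L ∷_) ∘ (L ∷_)) (2 ℕ.* n) ℕ.+ total LR (w ∘ (L ∷_) ∘ (R ∷_)) (2 ℕ.* n)) _ _ ⟨
  _ ∎)
  where
  open ≡-Reasoning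
  two : ∀ w m → total LR w (suc m) ≡ total LR (w ∘ (L ∷_)) m ℕ.+ total LR (w ∘ (R ∷_)) m
  two w m = trans (total-suc LR w m) (cong (total LR (w ∘ (L ∷_)) m ℕ.+_) (ℕₚ.+-identityʳ _))

sum-map-0 : ∀ {A : Set} (xs : List A) → sum (map (λ _ → 0) xs) ≡ 0
sum-map-0 []       = refl
sum-map-0 (x ∷ xs) = sum-map-0 xs

pairs-0 : ∀ {w} → (∀ u → w u ≡ 0) → pairs w ≈ const 0ℤ
pairs-0 w≡0 = ≈-trans (coeffwise λ n → cong +_ (trans (total-cong LR w≡0 (2 ℕ.* n)) (sum-map-0 (words LR (2 ℕ.* n)))))
  (coeffwise λ { zero → refl ; (suc n) → refl })

indicator : Bool → ℕ
indicator b = if b then 1 else 0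

closedFrom : ℤ → List Turn → Bool
closedFrom x w = ⌊ Pos.xc (trace (pos x true) w) ℤ.≟ + 0 ⌋

-- Completions of a meander standing at 4j after an even number of arcs, once the initial run of L's
-- is over; the name tells the last letter.
afterR afterL : ℤ → List Turn → ℕ
afterR j w = indicator (closedFrom (+ 4 ℤ.* j) w ∧ noLL w)
afterL j w = indicator (closedFrom (+ 4 ℤ.* j) w ∧ noLL (L ∷ w))

-- Completions while only L's have been read: two L's cancel, so after an even number of them the
-- curve is back at 0.
initialRun : List Turn → ℕ
initialRun w = indicator (closedFrom 0ℤ w ∧ noLL (dropInitialL w))

P Q : ℤ → FPS
P j = pairs (afterR j)
Q j = pairs (afterL j)

Z : FPS
Z = pairs initialRun

δ₀ : ℤ → FPS
δ₀ (+ zero) = const 1ℤ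
δ₀ _        = const 0ℤ

back : ∀ j → (+ 4 ℤ.* j ℤ.- + 2) ℤ.- + 2 ≡ + 4 ℤ.* (-1ℤ ℤ.+ j)
back = solve-∀

forth : ∀ j → (+ 4 ℤ.* j ℤ.+ + 2) ℤ.+ + 2 ≡ + 4 ℤ.* (1ℤ ℤ.+ j)
forth = solve-∀

stay : ∀ j → (+ 4 ℤ.* j ℤ.+ + 2) ℤ.- + 2 ≡ + 4 ℤ.* j
stay = solve-∀

dead : ∀ b → indicator (b ∧ false) ≡ 0
dead b = cong indicator (∧-zeroʳ b)

afterR-[] : ∀ j → const (+ afterR j []) ≈ δ₀ j
afterR-[] (+ zero)  = ≈-refl
afterR-[] (+ suc n) = ≈-refl
afterR-[] -[1+ n ]  = ≈-refl

-- The four terms are the pairs LL (forbidden), LR (to j - 1), RL (to j + 1, now ending in L) and RR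
-- (no displacement). In `Q-eq` the preceding L forbids LR too.
P-eq : ∀ j → P j ≈ δ₀ j ⊕ X ⊛ (P (ℤ.pred j) ⊕ Q (ℤ.suc j) ⊕ P j)
P-eq j = ≈-trans (pairs-unfold (afterR j)) (⊕-cong (afterR-[] j) (⊛-cong (≈-refl {X})
  (≈-trans (⊕-cong (⊕-cong (⊕-cong
    (pairs-0 (λ u → dead (closedFrom (+ 4 ℤ.* j) (L ∷ L ∷ u))))
    (pairs-cong (λ u → cong (λ x → indicator (closedFrom x u ∧ noLL u)) (back j))))
    (pairs-cong (λ u → cong (λ x → indicator (closedFrom x u ∧ noLL (L ∷ u))) (forth j))))
    (pairs-cong (λ u → cong (λ x → indicator (closedFrom x u ∧ noLL u)) (stay j))))
  (solve 3 (λ a b c → con 0ℤ :+ a :+ b :+ c := a :+ b :+ c) ≈-refl (P (ℤ.pred j)) (Q (ℤ.suc j)) (P j)))))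

Q-eq : ∀ j → Q j ≈ δ₀ j ⊕ X ⊛ (Q (ℤ.suc j) ⊕ P j)
Q-eq j = ≈-trans (pairs-unfold (afterL j)) (⊕-cong (afterR-[] j) (⊛-cong (≈-refl {X})
  (≈-trans (⊕-cong (⊕-cong (⊕-cong
    (pairs-0 (λ u → dead (closedFrom (+ 4 ℤ.* j) (L ∷ L ∷ u))))
    (pairs-0 (λ u → dead (closedFrom (+ 4 ℤ.* j) (L ∷ R ∷ u)))))
    (pairs-cong (λ u → cong (λ x → indicator (closedFrom x u ∧ noLL (L ∷ u))) (forth j))))
    (pairs-cong (λ u → cong (λ x → indicator (closedFrom x u ∧ noLL u)) (stay j))))
  (solve 2 (λ b c → con 0ℤ :+ con 0ℤ :+ b :+ c := b :+ c) ≈-refl (Q (ℤ.suc j)) (P j)))))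

-- LL prolongs the initial run, and the other pairs end it. All positions are closed numerals, so
-- the four weights agree by computation.
Z-eq : Z ≈ const 1ℤ ⊕ X ⊛ (Z ⊕ P -1ℤ ⊕ Q 1ℤ ⊕ P 0ℤ)
Z-eq = pairs-unfold initialRun

S-eq : S ≈ X ⊛ (Z ⊕ P -1ℤ)
S-eq = ≈-trans (coeffwise λ n → cong +_ (count-sum isFibMeander (words LR (2 ℕ.* n))))
  (≈-trans (pairs-unfold (λ w → indicator (isFibMeander w)))
  (≈-trans (⊕-cong (≈-refl {const 0ℤ}) (⊛-cong (≈-refl {X}) (⊕-cong (⊕-cong (≈-refl {Z ⊕ P -1ℤ}) (pairs-0 (λ _ → refl))) (pairs-0 (λ _ → refl)))))
  (solve 2 (λ x a → con 0ℤ :+ x :* (a :+ con 0ℤ :+ con 0ℤ) := x :* a) ≈-refl X (Z ⊕ P -1ℤ))))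

-- Closed forms for the meander completions

pow : FPS → ℕ → FPS
pow f zero    = const 1ℤ
pow f (suc k) = pow f k ⊛ f

-- p and r are √R times P and Q: the completions allowed after R but not after L are those that
-- begin with LR, whence Q j = P j - x P (j - 1).
p r : ℤ → FPS
p j = pow q ℤ.∣ j ∣
r j = p j ⊕ ⊝ (X ⊛ p (ℤ.pred j))

-- With `w` factored out this is the characteristic equation q = x(1 + q + q² - xq) of the geometric
-- solution. Substituting q = x(1 + z) turns it into x times the equation of `z`.
q-step : ∀ w → w ⊛ q ≈ const 0ℤ ⊛ T₀ ⊕ X ⊛ (w ⊕ (w ⊛ q ⊛ q ⊕ ⊝ (X ⊛ (w ⊛ q))) ⊕ w ⊛ q)
q-step w = modulo (w ⊛ X) z-equation
  (solve 3 (λ x z w → let q = :q x z in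
    w :* q := con 0ℤ :* :T₀ x z :+ x :* (w :+ (w :* q :* q :+ :- (x :* (w :* q))) :+ w :* q)
              :+ w :* x :* :z-relation x z) ≈-refl X z w)

-- The form for negative j, where |j| decreases to the right and the two neighbours exchange roles.
q-step′ : ∀ w → w ⊛ q ≈ const 0ℤ ⊛ T₀ ⊕ X ⊛ (w ⊛ q ⊛ q ⊕ (w ⊕ ⊝ (X ⊛ (w ⊛ q))) ⊕ w ⊛ q)
q-step′ w = ≈-trans (q-step w) (solve 4 (λ t x q w →
  con 0ℤ :* t :+ x :* (w :+ (w :* q :* q :+ :- (x :* (w :* q))) :+ w :* q)
  := con 0ℤ :* t :+ x :* (w :* q :* q :+ (w :+ :- (x :* (w :* q))) :+ w :* q)) ≈-refl T₀ X q w)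

p-eq : ∀ j → p j ≈ δ₀ j ⊛ T₀ ⊕ X ⊛ (p (ℤ.pred j) ⊕ r (ℤ.suc j) ⊕ p j)
-- The normalisation is fixed here: 1 - x(1 + 2q - x) is exactly `T₀`.
p-eq (+ zero)       = solve 2 (λ x z → let q = :q x z in
  con 1ℤ := con 1ℤ :* :T₀ x z :+ x :* (con 1ℤ :* q :+ (con 1ℤ :* q :+ :- (x :* con 1ℤ)) :+ con 1ℤ)) ≈-refl X z
p-eq (+ suc k)      = q-step (pow q k)
p-eq -[1+ zero ]    = q-step′ (pow q 0)
p-eq -[1+ suc k ]   = q-step′ (pow q (suc k))

r-eq : ∀ j → r j ≈ δ₀ j ⊛ T₀ ⊕ X ⊛ (r (ℤ.suc j) ⊕ p j)
r-eq j = ≈-trans (⊕-cong (p-eq j) (≈-refl {⊝ (X ⊛ p (ℤ.pred j))}))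
  (solve 5 (λ d x a b c → d :+ x :* (a :+ b :+ c) :+ :- (x :* a) := d :+ x :* (b :+ c)) ≈-refl
    (δ₀ j ⊛ T₀) X (p (ℤ.pred j)) (r (ℤ.suc j)) (p j))

meander-Φ : (Bool × ℤ → FPS) → Bool × ℤ → FPS
meander-Φ f (false , j) = f (false , ℤ.pred j) ⊕ f (true , ℤ.suc j) ⊕ f (false , j)
meander-Φ f (true  , j) = f (true , ℤ.suc j) ⊕ f (false , j)

PQ pr : Bool × ℤ → FPS
PQ (false , j) = P j ⊛ T₀
PQ (true  , j) = Q j ⊛ T₀
pr (false , j) = p j
pr (true  , j) = r j

PQ≈pr : ∀ i → PQ i ≈ pr i
PQ≈pr = guarded-unique (λ (_ , j) → δ₀ j ⊛ T₀) meander-Φ local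
  (λ { (false , j) → ≈-trans (⊛-cong (P-eq j) (≈-refl {T₀}))
         (solve 6 (λ d x t a b c → (d :+ x :* (a :+ b :+ c)) :* t := d :* t :+ x :* (a :* t :+ b :* t :+ c :* t)) ≈-refl
           (δ₀ j) X T₀ (P (ℤ.pred j)) (Q (ℤ.suc j)) (P j))
     ; (true , j) → ≈-trans (⊛-cong (Q-eq j) (≈-refl {T₀}))
         (solve 5 (λ d x t b c → (d :+ x :* (b :+ c)) :* t := d :* t :+ x :* (b :* t :+ c :* t)) ≈-refl
           (δ₀ j) X T₀ (Q (ℤ.suc j)) (P j)) })
  (λ { (false , j) → p-eq j ; (true , j) → r-eq j })
  where
  local : ∀ f g n → (∀ i → f i n ≡ g i n) → ∀ i → meander-Φ f i n ≡ meander-Φ g i n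
  local f g n f≡g (false , j) = cong₂ ℤ._+_ (cong₂ ℤ._+_ (f≡g _) (f≡g _)) (f≡g _)
  local f g n f≡g (true , j)  = cong₂ ℤ._+_ (f≡g _) (f≡g _)

-- Peeling off leading pairs LL: apart from the term xZ, the equation of `Z` has the same right-hand
-- side as that of `P 0ℤ`.
Z-P : (const 1ℤ ⊕ ⊝ X) ⊛ Z ≈ P 0ℤ
Z-P = modulo (const 1ℤ) Z-eq (≈-trans (solve 5 (λ x z a b c →
    (con 1ℤ :+ :- x) :* z := (con 1ℤ :+ x :* (a :+ b :+ c)) :+ con 1ℤ :* (z :+ :- (con 1ℤ :+ x :* (z :+ a :+ b :+ c)))) ≈-refl
    X Z (P -1ℤ) (Q 1ℤ) (P 0ℤ))
  (⊕-cong (≈-sym (P-eq 0ℤ)) (≈-refl {const 1ℤ ⊛ (Z ⊕ ⊝ (const 1ℤ ⊕ X ⊛ (Z ⊕ P -1ℤ ⊕ Q 1ℤ ⊕ P 0ℤ)))})))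

S-T₀ : (const 1ℤ ⊕ ⊝ X) ⊛ S ⊛ T₀ ≈ X ⊕ X ⊛ (const 1ℤ ⊕ ⊝ X) ⊛ q
S-T₀ = ≈-trans (⊛-cong (⊛-cong (≈-refl {const 1ℤ ⊕ ⊝ X}) S-eq) (≈-refl {T₀}))
  (≈-trans (solve 4 (λ x t z a → (con 1ℤ :+ :- x) :* (x :* (z :+ a)) :* t
                      := x :* (((con 1ℤ :+ :- x) :* z) :* t :+ (con 1ℤ :+ :- x) :* (a :* t))) ≈-refl X T₀ Z (P -1ℤ))
  (≈-trans (⊛-cong (≈-refl {X}) (⊕-cong (≈-trans (⊛-cong Z-P (≈-refl {T₀})) (PQ≈pr (false , 0ℤ)))
                                        (⊛-cong (≈-refl {const 1ℤ ⊕ ⊝ X}) (PQ≈pr (false , -1ℤ)))))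
    (solve 2 (λ x q → x :* (con 1ℤ :+ (con 1ℤ :+ :- x) :* (con 1ℤ :* q)) := x :+ x :* (con 1ℤ :+ :- x) :* q) ≈-refl X q)))

gf-identity : ∀ T → IsSqrtR T → S ⊛ denom T ≈ numer T
gf-identity T T-sqrt = ≈-trans (⊛-cong (≈-refl {S}) denom≈)
  -- Since R = `T₀`², the denominator factors as (x - 1)T₀(T₀ + x² - x - 1), which exposes (1 - x)S
  -- T₀.
  (≈-trans (solve 4 (λ x s t b → s :* ((con -1ℤ :+ x) :* (t :* t) :+ (con -1ℤ :+ x) :* b :* t) := :- ((con 1ℤ :+ :- x) :* s :* t) :* (t :+ b))
             ≈-refl X S T₀ (horner m₃))
  (≈-trans (⊛-cong (⊝-cong S-T₀) (≈-refl {T₀ ⊕ horner m₃}))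
  -- Here T₀ + x² - x - 1 = -2x(1 + xz), and modulo the equation of `z` both sides equal 2x²(1 + z).
  (≈-trans (modulo (const (+ 2) ⊛ X ⊛ X ⊛ (X ⊕ ⊝ const 1ℤ)) z-equation
     (solve 2 (λ x z → :- (x :+ x :* (con 1ℤ :+ :- x) :* :q x z) :* (:T₀ x z :+ :horner m₃ x)
        := :horner m₄ x :+ :- :T₀ x z :+ (con (+ 2) :* x :* x :* (x :+ :- con 1ℤ)) :* :z-relation x z) ≈-refl X z))
  (≈-sym (⊕-cong (poly≈horner m₄) (⊝-cong T≈T₀))))))
  where
  m₁ m₃ m₄ : List ℤ
  m₁ = ℤ.- + 1 ∷ + 1 ∷ []
  m₃ = ℤ.- + 1 ∷ ℤ.- + 1 ∷ + 1 ∷ []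
  m₄ = + 1 ∷ ℤ.- + 1 ∷ + 1 ∷ []
  T≈T₀ : T ≈ T₀
  T≈T₀ = sqrt-unique T T-sqrt
  x-1≈ : x-1 ≈ const -1ℤ ⊕ X
  x-1≈ = ≈-trans (poly≈horner m₁) (solve 1 (λ x → :horner m₁ x := con -1ℤ :+ x) ≈-refl X)
  denom≈ : denom T ≈ (const -1ℤ ⊕ X) ⊛ (T₀ ⊛ T₀) ⊕ (const -1ℤ ⊕ X) ⊛ horner m₃ ⊛ T₀
  denom≈ = ⊕-cong
    (≈-trans (solve 3 (λ a b c → a :* b :* c := a :* (b :* c)) ≈-refl x-1 x²+x+1 x²-3x+1)
             (⊛-cong x-1≈ (≈-sym T₀²≈R)))
    (⊛-cong (⊛-cong x-1≈ (poly≈horner m₃)) T≈T₀)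

-- Dyck paths with air pockets

below : (ℕ → ℕ) → ℕ → ℕ
below g zero    = 0
below g (suc h) = g h ℕ.+ below g h

top : (ℕ → ℕ) → ℕ → ℕ
top g zero    = 0
top g (suc h) = g h

-- E h m and F h m count the ways to finish a path from height h in m steps after a down-step and
-- after an up-step; H and K sum their numbers of factors UD₁, where K also counts the one that the
-- up-step just made may complete.
E F : ℕ → ℕ → ℕ
E h zero    = indicator ⌊ h ℕ.≟ 0 ⌋
E h (suc m) = F (suc h) m
F h zero    = indicator ⌊ h ℕ.≟ 0 ⌋
F h (suc m) = F (suc h) m ℕ.+ below (λ j → E j m) h

H K : ℕ → ℕ → ℕ
H h zero    = 0
H h (suc m) = K (suc h) m
K h zero    = 0
K h (suc m) = K (suc h) m ℕ.+ (top (λ j → E j m) h ℕ.+ below (λ j → H j m) h)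

walks-E walks-F walks-H walks-K : ℕ → List Step → ℕ
walks-E h ps = indicator (walkOK h true ps)
walks-F h ps = indicator (walkOK h false ps)
walks-H h ps = if walkOK h true ps then occUD1 ps else 0
walks-K h ps = if walkOK h false ps then occUD1 (U ∷ ps) else 0

total-steps : ∀ N w m → total (stepsUpTo N) w (suc m) ≡
  total (stepsUpTo N) (w ∘ (U ∷_)) m ℕ.+ sum (applyUpTo (λ i → total (stepsUpTo N) (w ∘ (D (suc i) ∷_)) m) N)
total-steps N w m = trans (total-suc (stepsUpTo N) w m) (cong (λ xs → total (stepsUpTo N) (w ∘ (U ∷_)) m ℕ.+ sum xs)
  (trans (sym (map-∘ (upTo N))) (map-applyUpTo id _ N)))

sum-applyUpTo-0 : ∀ N {φ : ℕ → ℕ} → (∀ i → φ i ≡ 0) → sum (applyUpTo φ N) ≡ 0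
sum-applyUpTo-0 zero    φ≡0 = refl
sum-applyUpTo-0 (suc N) φ≡0 = cong₂ ℕ._+_ (φ≡0 0) (sum-applyUpTo-0 N (φ≡0 ∘ suc))

sum-below : ∀ h N {φ g} → h ℕ.≤ N → (∀ i → φ i ≡ (if i <ᵇ h then g (h ∸ suc i) else 0)) →
  sum (applyUpTo φ N) ≡ below g h
sum-below zero    N       h≤N φ≡ = sum-applyUpTo-0 N φ≡
sum-below (suc h) (suc N) (ℕ.s≤s h≤N) φ≡ = cong₂ ℕ._+_ (φ≡ 0) (sum-below h N h≤N (φ≡ ∘ suc))

total-zero : ∀ {A : Set} (alph : List A) {w} → (∀ u → w u ≡ 0) → ∀ m → total alph w m ≡ 0
total-zero alph w≡0 m = trans (total-cong alph w≡0 m) (sum-map-0 (words alph m))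

total-+ : ∀ {A : Set} (alph : List A) v w m →
  total alph (λ u → v u ℕ.+ w u) m ≡ total alph v m ℕ.+ total alph w m
total-+ alph v w m = go (words alph m)
  where
  go : ∀ us → sum (map (λ u → v u ℕ.+ w u) us) ≡ sum (map v us) ℕ.+ sum (map w us)
  go []       = refl
  go (u ∷ us) rewrite go us = interchange (v u) (w u) _ _

-- Pulls the height test of a down-step out of the sum over suffixes; the decision `suc i ≤? h`
-- computes by `i <ᵇ h`.
guard : ∀ {A : Set} (alph : List A) i h (c : List A → Bool) (w : List A → ℕ) m →
  total alph (λ u → if ⌊ suc i ℕ.≤? h ⌋ ∧ c u then w u else 0) m ≡
  (if i <ᵇ h then total alph (λ u → if c u then w u else 0) m else 0)
guard alph i h c w m rewrite isYes≗does (suc i ℕ.≤? h) with i <ᵇ h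
... | true  = refl
... | false = sum-map-0 (words alph m)

drop-bound : ∀ h i m {N} → h ℕ.+ suc m ℕ.≤ N → (h ∸ suc i) ℕ.+ m ℕ.≤ N
drop-bound h i m h+m<N = ℕₚ.≤-trans (ℕₚ.+-mono-≤ (ℕₚ.m∸n≤m h (suc i)) (ℕₚ.n≤1+n m)) h+m<N

up-bound : ∀ h m {N} → h ℕ.+ suc m ℕ.≤ N → suc h ℕ.+ m ℕ.≤ N
up-bound h m p rewrite ℕₚ.+-suc h m = p

if-cong : ∀ b {x y : ℕ} → x ≡ y → (if b then x else 0) ≡ (if b then y else 0)
if-cong b = cong (λ v → if b then v else 0)

-- The bound h + m ≤ N guarantees that the alphabet U, D 1, …, D N misses no admissible down-step.
mutual
  E-total : ∀ N m h → h ℕ.+ m ℕ.≤ N → total (stepsUpTo N) (walks-E h) m ≡ E h m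
  E-total N zero    h h≤N = ℕₚ.+-identityʳ _
  E-total N (suc m) h h+m<N = begin
    total (stepsUpTo N) (walks-E h) (suc m) ≡⟨ total-steps N (walks-E h) m ⟩
    _ ≡⟨ cong₂ ℕ._+_ (F-total N m (suc h) (up-bound h m h+m<N))
                     (sum-applyUpTo-0 N (λ i → total-zero (stepsUpTo N) (λ _ → refl) m)) ⟩
    F (suc h) m ℕ.+ 0 ≡⟨ ℕₚ.+-identityʳ _ ⟩
    F (suc h) m ∎
    where open ≡-Reasoning

  F-total : ∀ N m h → h ℕ.+ m ℕ.≤ N → total (stepsUpTo N) (walks-F h) m ≡ F h m
  F-total N zero    h h≤N = ℕₚ.+-identityʳ _
  F-total N (suc m) h h+m<N = trans (total-steps N (walks-F h) m) (cong₂ ℕ._+_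
    (F-total N m (suc h) (up-bound h m h+m<N))
    (sum-below h N (ℕₚ.m+n≤o⇒m≤o h h+m<N) (λ i →
      trans (guard (stepsUpTo N) i h (walkOK (h ∸ suc i) true) (λ _ → 1) m)
            (if-cong (i <ᵇ h) (E-total N m (h ∸ suc i) (drop-bound h i m h+m<N))))))

if-+ : ∀ b x → (if b then suc x else 0) ≡ (if b then 1 else 0) ℕ.+ (if b then x else 0)
if-+ true  x = refl
if-+ false x = refl

mutual
  H-total : ∀ N m h → h ℕ.+ m ℕ.≤ N → total (stepsUpTo N) (walks-H h) m ≡ H h m
  H-total N zero    zero    h≤N = refl
  H-total N zero    (suc h) h≤N = refl
  H-total N (suc m) h h+m<N = begin
    total (stepsUpTo N) (walks-H h) (suc m) ≡⟨ total-steps N (walks-H h) m ⟩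
    _ ≡⟨ cong₂ ℕ._+_ (K-total N m (suc h) (up-bound h m h+m<N))
                     (sum-applyUpTo-0 N (λ i → total-zero (stepsUpTo N) (λ _ → refl) m)) ⟩
    K (suc h) m ℕ.+ 0 ≡⟨ ℕₚ.+-identityʳ _ ⟩
    K (suc h) m ∎
    where open ≡-Reasoning

  K-total : ∀ N m h → h ℕ.+ m ℕ.≤ N → total (stepsUpTo N) (walks-K h) m ≡ K h m
  K-total N zero    zero    h≤N = refl
  K-total N zero    (suc h) h≤N = refl
  K-total N (suc m) h h+m<N = trans (total-steps N (walks-K h) m)
    (cong₂ ℕ._+_ (K-total N m (suc h) (up-bound h m h+m<N)) (downs h N (ℕₚ.m+n≤o⇒m≤o h h+m<N)
      D1-total later-total))
    where
    open ≡-Reasoning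
    φ : ℕ → ℕ
    φ i = total (stepsUpTo N) (walks-K h ∘ (D (suc i) ∷_)) m
    -- Only `D 1` completes a factor UD₁ with the preceding U. The additional 1 in its weight
    -- contributes `E`, the later occurrences contribute `H`.
    D1-total : φ 0 ≡ (if 0 <ᵇ h then E (h ∸ 1) m ℕ.+ H (h ∸ 1) m else 0)
    D1-total = begin
      φ 0 ≡⟨ guard (stepsUpTo N) 0 h (walkOK (h ∸ 1) true) (λ ps → suc (occUD1 ps)) m ⟩
      _   ≡⟨ if-cong (0 <ᵇ h) (trans (total-cong (stepsUpTo N) (λ ps → if-+ (walkOK (h ∸ 1) true ps) (occUD1 ps)) m)
               (trans (total-+ (stepsUpTo N) (walks-E (h ∸ 1)) (walks-H (h ∸ 1)) m)
                      (cong₂ ℕ._+_ (E-total N m (h ∸ 1) (drop-bound h 0 m h+m<N))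
                                   (H-total N m (h ∸ 1) (drop-bound h 0 m h+m<N))))) ⟩
      _   ∎
    later-total : ∀ i → φ (suc i) ≡ (if suc i <ᵇ h then H (h ∸ suc (suc i)) m else 0)
    later-total i = trans (guard (stepsUpTo N) (suc i) h (walkOK (h ∸ suc (suc i)) true) occUD1 m)
      (if-cong (suc i <ᵇ h) (H-total N m (h ∸ suc (suc i)) (drop-bound h (suc i) m h+m<N)))
    downs : ∀ h N {φ : ℕ → ℕ} → h ℕ.≤ N → φ 0 ≡ (if 0 <ᵇ h then E (h ∸ 1) m ℕ.+ H (h ∸ 1) m else 0) →
      (∀ i → φ (suc i) ≡ (if suc i <ᵇ h then H (h ∸ suc (suc i)) m else 0)) →
      sum (applyUpTo φ N) ≡ top (λ j → E j m) h ℕ.+ below (λ j → H j m) h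
    downs zero    N       _ φ₀ φₛ = sum-applyUpTo-0 N (λ { zero → φ₀ ; (suc i) → φₛ i })
    downs (suc h) (suc N) (ℕ.s≤s h≤N) φ₀ φₛ =
      trans (cong₂ ℕ._+_ φ₀ (sum-below h N h≤N φₛ)) (ℕₚ.+-assoc (E h m) _ _)

Y₁≈H : Y₁ ≈ ogf (H 0)
Y₁≈H = coeffwise λ
  { zero          → refl
  ; (suc zero)    → refl
  ; (suc (suc m)) → cong +_ (begin
      Δ₁ (2 ℕ.+ m)
        ≡⟨ sum-filter isAirDyck occUD1 (words (stepsUpTo (2 ℕ.+ m)) (2 ℕ.+ m)) ⟩
      total (stepsUpTo (2 ℕ.+ m)) airDyck-occ (2 ℕ.+ m)
        ≡⟨ total-steps (2 ℕ.+ m) airDyck-occ (suc m) ⟩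
      -- After the forced first U, height plus remaining steps is exactly the path length, so the
      -- alphabet bound holds with equality.
      _ ≡⟨ cong₂ ℕ._+_ (K-total (2 ℕ.+ m) (suc m) 1 ℕₚ.≤-refl)
                       (sum-applyUpTo-0 (2 ℕ.+ m) (λ i → total-zero (stepsUpTo (2 ℕ.+ m)) (λ _ → refl) (suc m))) ⟩
      K 1 (suc m) ℕ.+ 0
        ≡⟨ ℕₚ.+-identityʳ _ ⟩
      K 1 (suc m) ∎) }
  where
  open ≡-Reasoning
  airDyck-occ : List Step → ℕ
  airDyck-occ ps = if isAirDyck ps then occUD1 ps else 0

-- Generating functions for the air-pocket suffixes

Below : (ℕ → FPS) → ℕ → FPS
Below f zero    = const 0ℤ
Below f (suc h) = f h ⊕ Below f h

Below-cong : ∀ {f g n} → (∀ j → f j n ≡ g j n) → ∀ h → Below f h n ≡ Below g h n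
Below-cong f≡g zero    = refl
Below-cong f≡g (suc h) = cong₂ ℤ._+_ (f≡g h) (Below-cong f≡g h)

Below-⊛ : ∀ f t h → Below f h ⊛ t ≈ Below (λ j → f j ⊛ t) h
Below-⊛ f t zero    = solve 1 (λ t → con 0ℤ :* t := con 0ℤ) ≈-refl t
Below-⊛ f t (suc h) = ≈-trans (⊛-distribʳ t (f h) (Below f h)) (⊕-cong (≈-refl {f h ⊛ t}) (Below-⊛ f t h))

below≡Below : ∀ (a : ℕ → ℕ → ℕ) h m → + below (λ j → a j m) h ≡ Below (λ j → ogf (a j)) h m
below≡Below a zero    zero    = refl
below≡Below a zero    (suc m) = refl
below≡Below a (suc h) m       = cong (ℤ._+_ (+ a h m)) (below≡Below a h m)

δℕ : ℕ → FPS
δℕ zero    = const 1ℤ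
δℕ (suc _) = const 0ℤ

Top : (ℕ → FPS) → ℕ → FPS
Top f zero    = const 0ℤ
Top f (suc h) = f h

top≡Top : ∀ (a : ℕ → ℕ → ℕ) h m → + top (λ j → a j m) h ≡ Top (λ j → ogf (a j)) h m
top≡Top a zero    zero    = refl
top≡Top a zero    (suc m) = refl
top≡Top a (suc h) m       = refl

air-Φ : (Bool × ℕ → FPS) → Bool × ℕ → FPS
air-Φ f (true  , h) = f (false , suc h)
air-Φ f (false , h) = f (false , suc h) ⊕ Below (λ j → f (true , j)) h

air-Φ-local : ∀ f g n → (∀ i → f i n ≡ g i n) → ∀ i → air-Φ f i n ≡ air-Φ g i n
air-Φ-local f g n f≡g (true  , h) = f≡g _
air-Φ-local f g n f≡g (false , h) = cong₂ ℤ._+_ (f≡g _) (Below-cong (λ j → f≡g (true , j)) h)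

EF HK : Bool × ℕ → FPS
EF (true  , h) = ogf (E h)
EF (false , h) = ogf (F h)
HK (true  , h) = ogf (H h)
HK (false , h) = ogf (K h)

cons-δ : ∀ {f g : FPS} h → f 0 ≡ + indicator ⌊ h ℕ.≟ 0 ⌋ → (∀ n → f (suc n) ≡ g n) → f ≈ δℕ h ⊕ X ⊛ g
cons-δ zero    = cons-≈
cons-δ (suc h) = cons-≈

EF-eq : ∀ i → EF i ≈ δℕ (proj₂ i) ⊕ X ⊛ air-Φ EF i
EF-eq (true  , h) = cons-δ h refl (λ _ → refl)
EF-eq (false , h) = cons-δ h refl (λ n → cong (ℤ._+_ (+ F (suc h) n)) (below≡Below E h n))

-- By `E≈` at height 0, `e` counts the non-empty paths and `ρ` adds the empty one.
e ρ : FPS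
e = X ⊛ z
ρ = const 1ℤ ⊕ e

EF-closed : Bool × ℕ → FPS
EF-closed (true  , zero)  = ρ
EF-closed (true  , suc h) = e ⊛ pow ρ (suc h)
EF-closed (false , zero)  = ρ
EF-closed (false , suc h) = z ⊛ pow ρ h

-- The sum ρ + eρ + eρ² + ... telescopes because e = ρ - 1. The equation of `F` at positive height
-- then becomes that of `z` times a power of `ρ`.
Below-E : ∀ h → Below (λ j → EF-closed (true , j)) (suc h) ≈ pow ρ (suc h)
Below-E zero    = solve 1 (λ r → r :+ con 0ℤ := con 1ℤ :* r) ≈-refl ρ
Below-E (suc h) = ≈-trans (⊕-cong (≈-refl {e ⊛ pow ρ (suc h)}) (Below-E h))
  (solve 2 (λ e w → e :* w :+ w := w :* (con 1ℤ :+ e)) ≈-refl e (pow ρ (suc h)))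

EF-closed-eq : ∀ i → EF-closed i ≈ δℕ (proj₂ i) ⊕ X ⊛ air-Φ EF-closed i
EF-closed-eq (true , zero) = solve 2 (λ x z → con 1ℤ :+ x :* z := con 1ℤ :+ x :* (z :* con 1ℤ)) ≈-refl X z
EF-closed-eq (true , suc h) = solve 3 (λ x z w → x :* z :* w := con 0ℤ :+ x :* (z :* w)) ≈-refl X z (pow ρ (suc h))
EF-closed-eq (false , zero) = solve 2 (λ x z → con 1ℤ :+ x :* z := con 1ℤ :+ x :* (z :* con 1ℤ :+ con 0ℤ)) ≈-refl X z
EF-closed-eq (false , suc h) = ≈-trans
  (modulo (pow ρ h) z-equation (solve 3 (λ x z w → let r = con 1ℤ :+ x :* z in
    z :* w := con 0ℤ :+ x :* (z :* (w :* r) :+ w :* r) :+ w :* :z-relation x z) ≈-refl X z (pow ρ h)))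
  (⊕-cong (≈-refl {const 0ℤ}) (⊛-cong (≈-refl {X}) (⊕-cong (≈-refl {z ⊛ pow ρ (suc h)}) (≈-sym (Below-E h)))))

E≈ : ∀ h → ogf (E h) ≈ EF-closed (true , h)
E≈ h = guarded-unique (δℕ ∘ proj₂) air-Φ air-Φ-local EF-eq EF-closed-eq (true , h)

HK-source : Bool × ℕ → FPS
HK-source (true  , h) = const 0ℤ
HK-source (false , h) = X ⊛ Top (λ j → ogf (E j)) h

HK-eq : ∀ i → HK i ≈ HK-source i ⊕ X ⊛ air-Φ HK i
HK-eq (true  , h) = cons-≈ refl (λ _ → refl)
HK-eq (false , h) = ≈-trans
  (cons-≈ {g = ogf (K (suc h)) ⊕ (Top (λ j → ogf (E j)) h ⊕ Below (λ j → ogf (H j)) h)} refl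
    (λ n → cong (ℤ._+_ (+ K (suc h) n)) (cong₂ ℤ._+_ (top≡Top E h n) (below≡Below H h n))))
  (solve 4 (λ x k t b → con 0ℤ :+ x :* (k :+ (t :+ b)) := x :* t :+ x :* (k :+ b)) ≈-refl
    X (ogf (K (suc h))) (Top (λ j → ogf (E j)) h) (Below (λ j → ogf (H j)) h))

HKT : Bool × ℕ → FPS
HKT i = HK i ⊛ T₀

HKT-source : Bool × ℕ → FPS
HKT-source (true  , h) = const 0ℤ
HKT-source (false , h) = X ⊛ Top (λ j → EF-closed (true , j)) h ⊛ T₀

Top-cong : ∀ {f g} → (∀ j → f j ≈ g j) → ∀ h → Top f h ≈ Top g h
Top-cong f≈g zero    = ≈-refl
Top-cong f≈g (suc h) = f≈g h

HKT-eq : ∀ i → HKT i ≈ HKT-source i ⊕ X ⊛ air-Φ HKT i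
HKT-eq (true , h) = ≈-trans (⊛-cong (HK-eq (true , h)) (≈-refl {T₀}))
  (solve 3 (λ x k t → (con 0ℤ :+ x :* k) :* t := con 0ℤ :+ x :* (k :* t)) ≈-refl X (ogf (K (suc h))) T₀)
HKT-eq (false , h) = ≈-trans (⊛-cong (HK-eq (false , h)) (≈-refl {T₀}))
  (≈-trans (solve 5 (λ x k t b a → (x :* a :+ x :* (k :+ b)) :* t := x :* a :* t :+ x :* (k :* t :+ b :* t)) ≈-refl
    X (ogf (K (suc h))) T₀ (Below (λ j → ogf (H j)) h) (Top (λ j → ogf (E j)) h))
  (⊕-cong (⊛-cong (⊛-cong (≈-refl {X}) (Top-cong E≈ h)) (≈-refl {T₀}))
    (⊛-cong (≈-refl {X}) (⊕-cong (≈-refl {ogf (K (suc h)) ⊛ T₀}) (Below-⊛ (λ j → ogf (H j)) T₀ h)))))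

-- G h = h e ρ^(h-1), the resonant part of the solution.
G : ℕ → FPS
G zero    = const 0ℤ
G (suc h) = G h ⊛ ρ ⊕ e ⊛ pow ρ h

-- The geometric pattern of `E` would give `e` at height 0, but the value is 1 + e. The extra 1, a
-- path ending with the D₁ just made, enters the source at height 1, scaled by `T₀`.
bonus : ℕ → FPS
bonus zero    = T₀
bonus (suc h) = const 0ℤ

-- The clause for height 0 is `X ⊛ K-closed 1` written out.
K-closed H-closed : ℕ → FPS
K-closed zero    = X ⊛ (X ⊛ (e ⊛ (const 1ℤ ⊕ T₀) ⊛ const 1ℤ ⊕ e ⊛ const 0ℤ ⊕ T₀))
K-closed (suc h) = X ⊛ (e ⊛ (const 1ℤ ⊕ T₀) ⊛ pow ρ h ⊕ e ⊛ G h ⊕ bonus h)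
H-closed h = X ⊛ K-closed (suc h)

HKT-closed : Bool × ℕ → FPS
HKT-closed (true  , h) = H-closed h
HKT-closed (false , h) = K-closed h

-- Telescoping again: raising h by one increases T₀ρ^h + h e ρ^(h-1) by e times itself plus eρ^h,
-- which is `H-closed` up to x².
Below-H : ∀ h → Below H-closed (suc h) ≈ X ⊛ (X ⊛ (T₀ ⊛ pow ρ (suc h) ⊕ G (suc h)))
Below-H zero = solve 3 (λ x e t → let r = con 1ℤ :+ e in
  x :* (x :* (e :* (con 1ℤ :+ t) :* con 1ℤ :+ e :* con 0ℤ :+ t)) :+ con 0ℤ
  := x :* (x :* (t :* (con 1ℤ :* r) :+ (con 0ℤ :* r :+ e :* con 1ℤ)))) ≈-refl X e T₀
Below-H (suc h) = ≈-trans (⊕-cong (≈-refl {H-closed (suc h)}) (Below-H h))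
  (solve 5 (λ x e t w g → x :* (x :* (e :* (con 1ℤ :+ t) :* w :+ e :* g :+ con 0ℤ)) :+ x :* (x :* (t :* w :+ g))
    := x :* (x :* (t :* (w :* (con 1ℤ :+ e)) :+ (g :* (con 1ℤ :+ e) :+ e :* w)))) ≈-refl
    X e T₀ (pow ρ (suc h)) (G (suc h)))

HKT-closed-eq : ∀ i → HKT-closed i ≈ HKT-source i ⊕ X ⊛ air-Φ HKT-closed i
HKT-closed-eq (true , h) = solve 2 (λ x k → x :* k := con 0ℤ :+ x :* k) ≈-refl X (K-closed (suc h))
HKT-closed-eq (false , zero) = solve 3 (λ x t k → x :* k := x :* con 0ℤ :* t :+ x :* (k :+ con 0ℤ)) ≈-refl X T₀ (K-closed 1)
HKT-closed-eq (false , suc zero) = ≈-trans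
  (modulo (X ⊛ X ⊛ T₀) z-equation (solve 2 (λ x z → let e = x :* z ; r = con 1ℤ :+ e ; t = :T₀ x z in
    x :* (e :* (con 1ℤ :+ t) :* con 1ℤ :+ e :* con 0ℤ :+ t)
    := x :* r :* t :+ x :* (x :* (e :* (con 1ℤ :+ t) :* (con 1ℤ :* r) :+ e :* (con 0ℤ :* r :+ e :* con 1ℤ) :+ con 0ℤ)
                            :+ x :* (x :* (t :* (con 1ℤ :* r) :+ (con 0ℤ :* r :+ e :* con 1ℤ))))
       :+ x :* x :* t :* :z-relation x z) ≈-refl X z))
  (⊕-cong (≈-refl {X ⊛ ρ ⊛ T₀}) (⊛-cong (≈-refl {X}) (⊕-cong (≈-refl {K-closed 2}) (≈-sym (Below-H 0)))))
-- The `G` terms cancel by z = x(1 + z)ρ. What remains is T₀ = 1 - x(ρ + e + x), the reason for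
-- scaling by √R.
HKT-closed-eq (false , suc (suc h)) = ≈-trans
  (modulo (X ⊛ X ⊛ (T₀ ⊛ pow ρ (suc h) ⊕ G (suc h))) z-equation
    (solve 4 (λ x z w g → let e = x :* z ; r = con 1ℤ :+ e ; t = :T₀ x z in
    x :* (e :* (con 1ℤ :+ t) :* w :+ e :* g :+ con 0ℤ)
    := x :* (e :* w) :* t :+ x :* (x :* (e :* (con 1ℤ :+ t) :* (w :* r) :+ e :* (g :* r :+ e :* w) :+ con 0ℤ)
                            :+ x :* (x :* (t :* (w :* r) :+ (g :* r :+ e :* w))))
       :+ x :* x :* (t :* w :+ g) :* :z-relation x z) ≈-refl X z (pow ρ (suc h)) (G (suc h))))
  (⊕-cong (≈-refl {X ⊛ (e ⊛ pow ρ (suc h)) ⊛ T₀})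
    (⊛-cong (≈-refl {X}) (⊕-cong (≈-refl {K-closed (suc (suc (suc h)))}) (≈-sym (Below-H (suc h))))))

Y₁-T₀ : Y₁ ⊛ T₀ ≈ H-closed 0
Y₁-T₀ = ≈-trans (⊛-cong Y₁≈H (≈-refl {T₀}))
  (guarded-unique HKT-source air-Φ air-Φ-local HKT-eq HKT-closed-eq (true , 0))

-- `T₀` has constant term 1 and can be cancelled; multiplied by it, both sides have closed forms in
-- x and `z`, supplied by `S-T₀` and `Y₁-T₀`.
Y₁-identity : (S ⊕ one) ⊛ x²[1-x] ≈ Y₁
Y₁-identity = ⊛-cancelʳ T₀ (≈-trans (⊛-cong (⊛-cong (≈-refl {S ⊕ one}) (poly≈horner m)) (≈-refl {T₀}))
  (≈-trans (solve 3 (λ x s t → (s :+ con 1ℤ) :* :horner m x :* t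
      := x :* x :* ((con 1ℤ :+ :- x) :* s :* t :+ (con 1ℤ :+ :- x) :* t)) ≈-refl X S T₀)
  (≈-trans (⊛-cong (≈-refl {X ⊛ X}) (⊕-cong S-T₀ (≈-refl {(const 1ℤ ⊕ ⊝ X) ⊛ T₀})))
  (≈-trans (modulo (const (ℤ.- + 2) ⊛ X ⊛ X ⊛ X) z-equation (solve 2 (λ x z → let e = x :* z ; t = :T₀ x z in
      x :* x :* (x :+ x :* (con 1ℤ :+ :- x) :* :q x z :+ (con 1ℤ :+ :- x) :* t)
      := x :* (x :* (e :* (con 1ℤ :+ t) :* con 1ℤ :+ e :* con 0ℤ :+ t))
         :+ con (ℤ.- + 2) :* x :* x :* x :* :z-relation x z) ≈-refl X z))
  (≈-sym Y₁-T₀)))))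
  where
  m : List ℤ
  m = + 0 ∷ + 0 ∷ + 1 ∷ ℤ.- + 1 ∷ []

theorem7 : ((T : FPS) → IsSqrtR T → ∀ n → (S ⊛ denom T) n ≡ numer T n)
    × (∀ n → ((S ⊕ one) ⊛ x²[1-x]) n ≡ Y₁ n)
theorem7 = (λ T T-sqrt → coeff (gf-identity T T-sqrt)) , coeff Y₁-identity
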